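{- Let $p$ be a prime with $p \equiv 1 \pmod 5$, let $\alpha\ge 1$ and $q = p^{\alpha}$. Let $\zeta = e^{2\pi i/5}$ and let $(a_1,a_2,a_3,a_4)\in\mathbb Z^4$ satisfy, with $H = a_1\zeta + a_2\zeta^2 + a_3\zeta^3 + a_4\zeta^4$, the following conditions: (i) $q = a_1^2+a_2^2+a_3^2+a_4^2 - \frac12 (a_1a_2+a_2a_3+a_3a_4+a_1a_3+a_2a_4+a_1a_4)$; (ii) $a_1a_2+a_2a_3+a_3a_4 = a_1a_3+a_2a_4+a_1a_4$; (iii) $1+a_1+a_2+a_3+a_4 \equiv 0 \pmod 5$; (iv) $a_1+2a_2+3a_3+4a_4\equiv 0 \pmod 5$; (v) $p$ does not divide $H\,\sigma_2(H)$ in $\mathbb Z[\zeta]$, where $\sigma_2$ is the automorphism of $\mathbb Q(\zeta)$ with $\sigma_2(\zeta)=\zeta^2$. Let $D$ be the $4\times 2$ matrix $$D = \begin{pmatrix} a_1-a_2+a_3 & a_4\\ a_3-a_4 & a_3\\ a_1 & a_2\\ a_1-a_2+a_3-a_4 & a_1\end{pmatrix},$$ with entries reduced modulo $p$ and regarded as elements of $\mathbb F_p\subseteq \mathbb F_q$. Then any two rows of $D$ are linearly independent, and the matrix $G = D^t$ is a generator matrix of an MDS code of type $[4,2,3]$ over $\mathbb F_q$.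
   Context: An $[n,k,d]$-code over $\mathbb F_q$ is a linear subspace of $\mathbb F_q^n$ of dimension $k$ and minimum (Hamming) distance $d$. It is called MDS (maximum distance separable) if $n+1=k+d$. A generator matrix of a linear code is a matrix whose rows form a basis of the code. Conditions (i)–(v) are a known arithmetic characterization of Jacobi sums of order $5$: for a generator $\gamma$ of $\mathbb F_q^*$ let $\chi$ be the character of $\mathbb F_q^*$ with $\chi(\gamma)=\zeta$, and put $J(1,1) = \sum_{v\in\mathbb F_q,\ v\ne 0,-1}\chi(v)\chi(v+1)$. Then integers $(a_1,a_2,a_3,a_4)$ satisfy (i)–(v) if and only if $a_1\zeta+a_2\zeta^2+a_3\zeta^3+a_4\zeta^4$ is one of the conjugates of $J(1,1)$ under $\mathrm{Gal}(\mathbb Q(\zeta)/\mathbb Q)$, equivalently, if and only if it equals $J(1,1)$ for some choice of the generator $\gamma$ of $\mathbb F_q^*$. -}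

module Defs where

open import Algebra.Bundles using (CommutativeRing; RawRing)
import Algebra.Definitions.RawSemiring as RawSemiringDefinitions
open import Data.Fin.Base using (Fin)
import Data.Fin.Properties as Fin
open import Data.Integer.Base using (ℤ; +_; _%ℕ_)
import Data.Integer.Base as Int
open import Data.List.Base using (filter; allFin; length)
open import Data.Nat.Base using (ℕ; NonZero)
import Data.Nat.Base as Nat
open import Data.Product.Base using (∃-syntax; _×_; _,_)
open import Data.Vec.Functional using (Vector; []; _∷_; zipWith; map; replicate)
import Data.Vec.Functional.Relation.Binary.Equality.Setoid as VectorEquality
open import Function.Bundles using (Inverse)
open import Function.Properties.Inverse using (Inverse⇒Injection)
open import Level using (0ℓ; _⊔_; suc)
open import Relation.Binary.Definitions using (Decidable)
open import Relation.Binary.PropositionalEquality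
  using (_≡_; refl)
import Relation.Binary.PropositionalEquality as ≡
open import Relation.Nullary using (¬_; ¬?)
open import Relation.Nullary.Decidable using (via-injection)
open import Relation.Unary using (Pred; _∈_)

-- For ζ a primitive fifth root of unity, ℤ[ζ] ≅ ℤ[x] / (1 + x + x² + x³ + x⁴)
-- is free over ℤ on 1, ζ, ζ², ζ³, with ζ⁴ = - 1 - ζ - ζ² - ζ³ and ζ⁵ = 1.

data ℤ[ζ] : Set where
  _∙1+_∙ζ+_∙ζ²+_∙ζ³ : (a b c d : ℤ) → ℤ[ζ]

infix 5 _∙1+_∙ζ+_∙ζ²+_∙ζ³

module _ where
  open Int using (_+_; _*_; _-_; -_)

  infixl 6 _⊕_
  infixl 7 _⊛_
  infix  8 ⊖_

  _⊕_ : ℤ[ζ] → ℤ[ζ] → ℤ[ζ]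
  (a ∙1+ b ∙ζ+ c ∙ζ²+ d ∙ζ³) ⊕ (a′ ∙1+ b′ ∙ζ+ c′ ∙ζ²+ d′ ∙ζ³) =
    (a + a′) ∙1+ (b + b′) ∙ζ+ (c + c′) ∙ζ²+ (d + d′) ∙ζ³

  ⊖_ : ℤ[ζ] → ℤ[ζ]
  ⊖ (a ∙1+ b ∙ζ+ c ∙ζ²+ d ∙ζ³) = (- a) ∙1+ (- b) ∙ζ+ (- c) ∙ζ²+ (- d) ∙ζ³

  -- The subtracted term is the coefficient of ζ⁴ in the unreduced product;
  -- the coefficients of ζ⁵ and ζ⁶ are added to those of 1 and ζ.
  _⊛_ : ℤ[ζ] → ℤ[ζ] → ℤ[ζ]
  (a ∙1+ b ∙ζ+ c ∙ζ²+ d ∙ζ³) ⊛ (a′ ∙1+ b′ ∙ζ+ c′ ∙ζ²+ d′ ∙ζ³) =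
         (a * a′ + (c * d′ + d * c′)          - (b * d′ + c * c′ + d * b′))
    ∙1+  (a * b′ + b * a′ + d * d′            - (b * d′ + c * c′ + d * b′))
    ∙ζ+  (a * c′ + b * b′ + c * a′            - (b * d′ + c * c′ + d * b′))
    ∙ζ²+ (a * d′ + b * c′ + c * b′ + d * a′   - (b * d′ + c * c′ + d * b′))
    ∙ζ³

  -- ζ ↦ ζ² sends a + b ζ + c ζ² + d ζ³ to a + b ζ² + c ζ⁴ + d ζ.
  σ₂ : ℤ[ζ] → ℤ[ζ]
  σ₂ (a ∙1+ b ∙ζ+ c ∙ζ²+ d ∙ζ³) =
    (a - c) ∙1+ (d - c) ∙ζ+ (b - c) ∙ζ²+ (- c) ∙ζ³

fromℤ : ℤ → ℤ[ζ]
fromℤ a = a ∙1+ (+ 0) ∙ζ+ (+ 0) ∙ζ²+ (+ 0) ∙ζ³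

ζ : ℤ[ζ]
ζ = (+ 0) ∙1+ (+ 1) ∙ζ+ (+ 0) ∙ζ²+ (+ 0) ∙ζ³

ℤ[ζ]-rawRing : RawRing 0ℓ 0ℓ
ℤ[ζ]-rawRing = record
  { Carrier = ℤ[ζ]
  ; _≈_ = _≡_
  ; _+_ = _⊕_
  ; _*_ = _⊛_
  ; -_  = ⊖_
  ; 0#  = fromℤ (+ 0)
  ; 1#  = fromℤ (+ 1)
  }

module ℤ[ζ]-Ring where
  open RawRing ℤ[ζ]-rawRing public using (_+_; _*_; -_; 0#; 1#)
  open RawSemiringDefinitions (RawRing.rawSemiring ℤ[ζ]-rawRing) public
    using (_^_; _∣_)

module _ where
  open ℤ[ζ]-Ring

  ζ-cyclotomic : 1# + ζ + ζ ^ 2 + ζ ^ 3 + ζ ^ 4 ≡ 0#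
  ζ-cyclotomic = refl

  σ₂-ζ^ : (σ₂ 1# ≡ 1#) × (σ₂ ζ ≡ ζ ^ 2) × (σ₂ (ζ ^ 2) ≡ ζ ^ 4) × (σ₂ (ζ ^ 3) ≡ ζ ^ 6)
  σ₂-ζ^ = refl , refl , refl , refl

  H : (a₁ a₂ a₃ a₄ : ℤ) → ℤ[ζ]
  H a₁ a₂ a₃ a₄ =
    fromℤ a₁ * ζ + fromℤ a₂ * ζ ^ 2 + fromℤ a₃ * ζ ^ 3 + fromℤ a₄ * ζ ^ 4

record FiniteField (q : ℕ) c ℓ : Set (suc (c ⊔ ℓ)) where
  field
    commutativeRing : CommutativeRing c ℓ

  open CommutativeRing commutativeRing public

  field
    1≉0         : ¬ 1# ≈ 0#
    invertible  : ∀ x → ¬ x ≈ 0# → ∃[ y ] x * y ≈ 1#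
    enumeration : Inverse setoid (≡.setoid (Fin q))

  infix 4 _≟_

  _≟_ : Decidable _≈_
  _≟_ = via-injection (Inverse⇒Injection enumeration) Fin._≟_

module Coding {q c ℓ} (F : FiniteField q c ℓ) where
  open FiniteField F using (Carrier; _≈_; _+_; _*_; 0#; 1#; _≟_)
  open RawSemiringDefinitions (RawRing.rawSemiring (FiniteField.rawRing F))
    using () renaming (_×_ to _·ℕ_; sum to ∑)
  open VectorEquality (FiniteField.setoid F) public
    using (_≋_)

  -- For q a power of the prime p: reduction modulo p, followed by the
  -- inclusion 𝔽ₚ ⊆ 𝔽_q, under which r ∈ {0, …, p - 1} is r · 1.
  reduce : (p : ℕ) .{{_ : NonZero p}} → ℤ → Carrier
  reduce p a = (a %ℕ p) ·ℕ 1#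

  -- An m × n matrix is the vector of its m rows.
  Matrix : ℕ → ℕ → Set c
  Matrix m n = Vector (Vector Carrier n) m

  combination : ∀ {m n} → Vector Carrier m → Matrix m n → Vector Carrier n
  combination coeffs vs j = ∑ (λ i → coeffs i * vs i j)

  LinearlyIndependent : ∀ {m n} → Matrix m n → Set (c ⊔ ℓ)
  LinearlyIndependent {m} {n} vs = ∀ (coeffs : Vector Carrier m) →
    combination coeffs vs ≋ replicate n 0# → ∀ i → coeffs i ≈ 0#

  Subset : ℕ → Set (suc (c ⊔ ℓ))
  Subset n = Pred (Vector Carrier n) (c ⊔ ℓ)

  record IsSubspace {n} (C : Subset n) : Set (c ⊔ ℓ) where
    field
      respects : ∀ {x y} → x ≋ y → x ∈ C → y ∈ C
      0∈       : replicate n 0# ∈ C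
      +-closed : ∀ {x y} → x ∈ C → y ∈ C → zipWith _+_ x y ∈ C
      *-closed : ∀ a {x} → x ∈ C → map (a *_) x ∈ C

  record IsBasis {n k} (vs : Matrix k n) (C : Subset n) : Set (c ⊔ ℓ) where
    field
      rows∈       : ∀ i → vs i ∈ C
      independent : LinearlyIndependent vs
      spanning    : ∀ {x} → x ∈ C → ∃[ coeffs ] x ≋ combination coeffs vs

  HasDimension : ∀ {n} → Subset n → ℕ → Set (c ⊔ ℓ)
  HasDimension {n} C k = ∃[ vs ] IsBasis {n} {k} vs C

  hammingDistance : ∀ {n} → Vector Carrier n → Vector Carrier n → ℕ
  hammingDistance {n} x y = length (filter (λ i → ¬? (x i ≟ y i)) (allFin n))

  record HasMinimumDistance {n} (C : Subset n) (d : ℕ) : Set (c ⊔ ℓ) where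
    field
      lowerBound : ∀ {x y} → x ∈ C → y ∈ C → ¬ x ≋ y → d Nat.≤ hammingDistance x y
      attained   : ∃[ x ] ∃[ y ]
                   (x ∈ C × y ∈ C × ¬ x ≋ y × hammingDistance x y ≡ d)

  record IsCode (n k d : ℕ) (C : Subset n) : Set (c ⊔ ℓ) where
    field
      isSubspace      : IsSubspace C
      dimension       : HasDimension C k
      minimumDistance : HasMinimumDistance C d

  record IsMDSCode (n k d : ℕ) (C : Subset n) : Set (c ⊔ ℓ) where
    field
      isCode : IsCode n k d C
      mds    : n Nat.+ 1 ≡ k Nat.+ d

  IsGeneratorMatrix : ∀ {n k} → Matrix k n → Subset n → Set (c ⊔ ℓ)
  IsGeneratorMatrix G C = IsBasis G C

  module _ (p : ℕ) .{{_ : NonZero p}} where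
    open Int using (_-_) renaming (_+_ to _+ᶻ_)

    matrixD : (a₁ a₂ a₃ a₄ : ℤ) → Matrix 4 2
    matrixD a₁ a₂ a₃ a₄ = map (map (reduce p))
      ( ((a₁ - a₂ +ᶻ a₃)      ∷ a₄ ∷ [])
      ∷ ((a₃ - a₄)            ∷ a₃ ∷ [])
      ∷ (a₁                   ∷ a₂ ∷ [])
      ∷ ((a₁ - a₂ +ᶻ a₃ - a₄) ∷ a₁ ∷ [])
      ∷ [])

{-# OPTIONS --safe #-}

-- Let X = H σ₂(H).  Conditions (i) and (ii) say that the product of H with its complex conjugate is q,
-- so modulo p the product of any two distinct conjugates of X vanishes.  Hence the integers
-- tⱼ ≡ - Tr(ζ⁻²ʲ X) / 5 modulo p, j ∈ ℤ/5, satisfy tⱼ tₖ ≡ t₀ tⱼ₊ₖ, and their sum is ≡ 0.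
-- If t₀ ≡ 0 then every tⱼ ≡ 0, which makes X divisible by p, against (v).  So t₀ is invertible
-- modulo p, and the tⱼ / t₀ are the powers of a fifth root of unity ω ≠ 1.  Modulo p the six minors
-- of D are t₀, t₂, t₃, t₁ + t₂, t₂ + t₃ and t₃ + t₄, that is, t₀ times a power of ω, times
-- possibly 1 + ω; none of them vanishes.

module Submission where

open import Algebra.Definitions.RawMagma using (_,_)
open import Data.Fin.Base as Fin using (Fin; zero; suc)
open import Data.Fin.Patterns using (0F; 1F; 2F; 3F)
import Data.Fin.Properties as Fin
open import Data.Integer.Base using (ℤ; +_; -[1+_]; _+_; _-_; -_; _*_; _%ℕ_; _/ℕ_)
import Data.Integer.DivMod as Int
open import Data.Integer.Divisibility using () renaming (_∣_ to _∣ℤ_)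
open import Data.Integer.Divisibility.Signed
  using (_∣_; divides; ∣ᵤ⇒∣; ∣m∣n⇒∣m+n; ∣m∣n⇒∣m-n; ∣m⇒∣-m; ∣n⇒∣m*n)
import Data.Integer.Properties as Int
open import Data.Integer.Solver using (module +-*-Solver)
open import Data.List.Base as List using (length; filter; allFin)
open import Data.List.Properties using (filter-all; filter-reject)
import Data.List.Relation.Unary.All as All
open import Data.List.Relation.Unary.AllPairs as AllPairs using (AllPairs)
open import Data.List.Relation.Unary.AllPairs.Properties using (tabulate⁺)
open import Data.Nat.Base as ℕ using (ℕ; zero; suc; NonZero; _≤_; _^_; _%_; s≤s; s<s; z≤n)
import Data.Nat.Coprimality as ℕ
import Data.Nat.Divisibility as ℕ
import Data.Nat.GCD as ℕ
open import Data.Nat.Primality using (Prime; prime⇒nonZero)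
import Data.Nat.Properties as ℕ
open import Data.Product.Base using (∃-syntax; _×_; _,_)
open import Data.Rational.Unnormalised.Base using (_/_; _≃_; ½) renaming (_-_ to _-ℚ_; _*_ to _*ℚ_)
open import Data.Rational.Unnormalised.Properties using (drop-*≡*)
open import Data.Vec.Base as Vec using (Vec)
open import Data.Vec.Functional using (Vector; transpose; []; _∷_)
open import Function.Base using (_∘_; id)
open import Function.Bundles using (Inverse; mk↔ₛ′)
open import Level using (Level)
open import Relation.Binary.Definitions using (tri<; tri≈; tri>)
open import Relation.Binary.PropositionalEquality as ≡ using (_≡_; _≢_)
open import Relation.Nullary using (¬_; ¬?; yes; no; contradiction)
open import Relation.Unary using (Pred; Decidable)
open import Defs

private variable
  a ℓ : Level
  A : Set a

-- Finite fields: cancellation and the characteristic.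

module FieldNotation {q c ℓ} (F : FiniteField q c ℓ) where
  open FiniteField F public
    hiding (zero)
    renaming ( _+_ to infixl 6 _+ᶠ_; _-_ to infixl 6 _-ᶠ_
             ; _*_ to infixl 7 _*ᶠ_; -_ to infix 8 -ᶠ_ )

module FieldProperties {q c ℓ} (F : FiniteField q c ℓ) where
  open FieldNotation F
  open Inverse enumeration using (to; from; to-cong; strictlyInverseˡ; strictlyInverseʳ)
  open import Algebra.Properties.Semiring.Mult semiring using (×1-homo-*) renaming (_×_ to _·_)
  open import Algebra.Properties.CommutativeMonoid.Sum +-commutativeMonoid
  open import Algebra.Properties.Group +-group
    using (identityʳ-unique; //-rightDividesˡ; //-rightDividesʳ)
  open import Relation.Binary.Reasoning.Setoid setoid

  ≉0∧*≈*⇒≈ : ∀ {x y z} → ¬ x ≈ 0# → x *ᶠ y ≈ x *ᶠ z → y ≈ z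
  ≉0∧*≈*⇒≈ {x} {y} {z} x≉0 xy≈xz with invertible x x≉0
  ... | x⁻¹ , xx⁻¹≈1 = begin
    y                    ≈⟨ x⁻¹[xw]≈w y ⟨
    x⁻¹ *ᶠ (x *ᶠ y)      ≈⟨ *-congˡ xy≈xz ⟩
    x⁻¹ *ᶠ (x *ᶠ z)      ≈⟨ x⁻¹[xw]≈w z ⟩
    z                    ∎
    where
    x⁻¹[xw]≈w : ∀ w → x⁻¹ *ᶠ (x *ᶠ w) ≈ w
    x⁻¹[xw]≈w w = begin
      x⁻¹ *ᶠ (x *ᶠ w)  ≈⟨ *-assoc x⁻¹ x w ⟨
      x⁻¹ *ᶠ x *ᶠ w    ≈⟨ *-congʳ (trans (*-comm x⁻¹ x) xx⁻¹≈1) ⟩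
      1# *ᶠ w          ≈⟨ *-identityˡ w ⟩
      w                ∎

  ≉0∧*≈0⇒≈0 : ∀ {x y} → ¬ x ≈ 0# → x *ᶠ y ≈ 0# → y ≈ 0#
  ≉0∧*≈0⇒≈0 {x} x≉0 xy≈0 = ≉0∧*≈*⇒≈ x≉0 (trans xy≈0 (sym (zeroʳ x)))

  square≈0⇒≈0 : ∀ {x} → x *ᶠ x ≈ 0# → x ≈ 0#
  square≈0⇒≈0 {x} xx≈0 with x ≟ 0#
  ... | yes x≈0 = x≈0
  ... | no  x≉0 = ≉0∧*≈0⇒≈0 x≉0 xx≈0

  -- Translation by 1 permutes the field, so it does not change the sum of all elements.
  order·1≈0 : q · 1# ≈ 0#
  order·1≈0 = identityʳ-unique (sum from) (q · 1#) (begin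
    sum from +ᶠ q · 1#                    ≈⟨ +-congˡ (sum-replicate q) ⟨
    sum from +ᶠ sum {q} (λ _ → 1#)        ≈⟨ ∑-distrib-+ from (λ _ → 1#) ⟨
    sum (λ i → from i +ᶠ 1#)              ≈⟨ sum-cong-≋ (λ i → strictlyInverseʳ (from i +ᶠ 1#)) ⟨
    sum (λ i → from (to (from i +ᶠ 1#)))  ≈⟨ sum-permute from translation ⟨
    sum from                              ∎)
    where
    translation = mk↔ₛ′ (λ i → to (from i +ᶠ 1#)) (λ i → to (from i -ᶠ 1#))
      (λ i → ≡.trans
        (to-cong (trans (+-congʳ (strictlyInverseʳ _)) (//-rightDividesˡ 1# (from i))))
        (strictlyInverseˡ i))
      (λ i → ≡.trans
        (to-cong (trans (+-congʳ (strictlyInverseʳ _)) (//-rightDividesʳ 1# (from i))))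
        (strictlyInverseˡ i))

  -- The multiple `(n ^ k) · 1#` is a power of `n · 1#`, and a field has no nilpotents. This turns q
  -- · 1 = 0 into p · 1 = 0.
  ^·1≈0⇒·1≈0 : ∀ n k → (n ^ k) · 1# ≈ 0# → n · 1# ≈ 0#
  ^·1≈0⇒·1≈0 n zero    1≈0 = contradiction (trans (sym (+-identityʳ 1#)) 1≈0) 1≉0
  ^·1≈0⇒·1≈0 n (suc k) nnᵏ≈0 with n · 1# ≟ 0#
  ... | yes n≈0 = n≈0
  ... | no  n≉0 = ^·1≈0⇒·1≈0 n k
    (≉0∧*≈0⇒≈0 n≉0 (trans (sym (×1-homo-* n (n ^ k))) nnᵏ≈0))

-- Row spaces of matrices and the minimum distance when all minors are nonzero.

module _ {P : Pred A ℓ} (P? : Decidable P) where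

  -- Once an entry fails `P`, all later ones satisfy it, so filtering drops at most one entry. It
  -- will bound the coordinates where two codewords agree.
  length-filter-allPairs : ∀ {xs} → AllPairs (λ x y → ¬ P x → P y) xs →
                           length xs ≤ suc (length (filter P? xs))
  length-filter-allPairs AllPairs.[]                         = z≤n
  length-filter-allPairs {x List.∷ xs} (¬Px⇒Pxs AllPairs.∷ pairs) with P? x
  ... | yes _  = s≤s (length-filter-allPairs pairs)
  ... | no ¬Px = s≤s (ℕ.≤-reflexive (≡.cong length
    (≡.sym (filter-all P? (All.map (λ ¬Px⇒Py → ¬Px⇒Py ¬Px) ¬Px⇒Pxs)))))

module Span {q c ℓ} (F : FiniteField q c ℓ) where
  open FieldNotation F
  open Coding F
  open FieldProperties F
  open import Algebra.Properties.Semiring.Sum semiring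
    using (sum-cong-≋; ∑-distrib-+; *-distribˡ-sum; sum-replicate-zero)
  open import Algebra.Properties.Group +-group
    using (∙-cancelʳ; identityˡ-unique; //-rightDividesˡ; x∙y⁻¹≈ε⇒x≈y; x≈y⇒x∙y⁻¹≈ε)
  open import Algebra.Properties.Ring ring using (-‿distribˡ-*)
  open import Algebra.Solver.Ring.NaturalCoefficients.Default commutativeSemiring
    using (solve; _:=_; _:+_; _:*_; con)
  open import Relation.Binary.Reasoning.Setoid setoid

  span : ∀ {m n} → Matrix m n → Subset n
  span vs x = ∃[ coeffs ] x ≋ combination coeffs vs

  combination-cong : ∀ {m n} {d e} (vs : Matrix m n) → d ≋ e → combination d vs ≋ combination e vs
  combination-cong vs d≋e j = sum-cong-≋ (λ i → *-congʳ (d≋e i))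

  combination-+ : ∀ {m n} d e (vs : Matrix m n) →
    combination (λ i → d i +ᶠ e i) vs ≋ (λ j → combination d vs j +ᶠ combination e vs j)
  combination-+ d e vs j = trans
    (sum-cong-≋ (λ i → distribʳ (vs i j) (d i) (e i)))
    (∑-distrib-+ (λ i → d i *ᶠ vs i j) (λ i → e i *ᶠ vs i j))

  combination-* : ∀ {m n} x d (vs : Matrix m n) →
    combination (λ i → x *ᶠ d i) vs ≋ (λ j → x *ᶠ combination d vs j)
  combination-* x d vs j = trans
    (sum-cong-≋ (λ i → *-assoc x (d i) (vs i j)))
    (sym (*-distribˡ-sum x (λ i → d i *ᶠ vs i j)))

  combination-0 : ∀ {m n} (vs : Matrix m n) → combination (λ _ → 0#) vs ≋ (λ _ → 0#)
  combination-0 {m} vs j = trans (sum-cong-≋ (λ i → zeroˡ (vs i j))) (sum-replicate-zero m)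

  span-isSubspace : ∀ {m n} (vs : Matrix m n) → IsSubspace (span vs)
  span-isSubspace vs = record
    { respects = λ x≋y (d , x≋d) → d , λ j → trans (sym (x≋y j)) (x≋d j)
    ; 0∈       = (λ _ → 0#) , λ j → sym (combination-0 vs j)
    ; +-closed = λ (d , x≋d) (e , y≋e) → (λ i → d i +ᶠ e i) ,
        λ j → trans (+-cong (x≋d j) (y≋e j)) (sym (combination-+ d e vs j))
    ; *-closed = λ x (d , y≋d) → (λ i → x *ᶠ d i) ,
        λ j → trans (*-congˡ (y≋d j)) (sym (combination-* x d vs j))
    }

  rows∈span : ∀ {m n} (vs : Matrix m n) i → span vs (vs i)
  rows∈span vs zero    = (1# ∷ λ _ → 0#) , λ j → sym (trans
    (+-cong (*-identityˡ (vs zero j)) (combination-0 (vs ∘ suc) j)) (+-identityʳ (vs zero j)))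
  rows∈span vs (suc i) with rows∈span (vs ∘ suc) i
  ... | d , vᵢ≋d = (0# ∷ d) , λ j → sym (trans
    (+-cong (zeroˡ (vs zero j)) (sym (vᵢ≋d j))) (+-identityˡ (vs (suc i) j)))

  independent⇒basis : ∀ {m n} {vs : Matrix m n} → LinearlyIndependent vs → IsBasis vs (span vs)
  independent⇒basis {vs = vs} independent = record
    { rows∈ = rows∈span vs ; independent = independent ; spanning = id }

  module _ {x₀ x₁ y₀ y₁} (nonsingular : ¬ x₀ *ᶠ y₁ ≈ x₁ *ᶠ y₀) where

    -- The first equation times `y₁` and the second times `y₀` share the term in `e`; cancelling it,
    -- and then a nonzero `d`, contradicts nonsingularity. The trailing `0#` is the end of the
    -- unfolded sum over two rows.
    cramerˡ : ∀ {d e} → d *ᶠ x₀ +ᶠ (e *ᶠ y₀ +ᶠ 0#) ≈ 0# → d *ᶠ x₁ +ᶠ (e *ᶠ y₁ +ᶠ 0#) ≈ 0# → d ≈ 0#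
    cramerˡ {d} {e} eq₀ eq₁ with d ≟ 0#
    ... | yes d≈0 = d≈0
    ... | no  d≉0 = contradiction (≉0∧*≈*⇒≈ d≉0 (∙-cancelʳ (e *ᶠ y₀ *ᶠ y₁) _ _ (begin
      d *ᶠ (x₀ *ᶠ y₁) +ᶠ e *ᶠ y₀ *ᶠ y₁
        ≈⟨ solve 5 (λ d e x y z →
             d :* (x :* z) :+ e :* y :* z := (d :* x :+ (e :* y :+ con 0)) :* z) refl d e x₀ y₀ y₁ ⟩
      (d *ᶠ x₀ +ᶠ (e *ᶠ y₀ +ᶠ 0#)) *ᶠ y₁  ≈⟨ trans (*-congʳ eq₀) (zeroˡ y₁) ⟩
      0#                                  ≈⟨ trans (*-congʳ eq₁) (zeroˡ y₀) ⟨
      (d *ᶠ x₁ +ᶠ (e *ᶠ y₁ +ᶠ 0#)) *ᶠ y₀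
        ≈⟨ solve 5 (λ d e x y z →
             d :* (x :* z) :+ e :* z :* y := (d :* x :+ (e :* y :+ con 0)) :* z) refl d e x₁ y₁ y₀ ⟨
      d *ᶠ (x₁ *ᶠ y₀) +ᶠ e *ᶠ y₀ *ᶠ y₁    ∎))) nonsingular

  cramer : ∀ {x₀ x₁ y₀ y₁} → ¬ x₀ *ᶠ y₁ ≈ x₁ *ᶠ y₀ → (d : Vector Carrier 2) →
    d 0F *ᶠ x₀ +ᶠ (d 1F *ᶠ y₀ +ᶠ 0#) ≈ 0# → d 0F *ᶠ x₁ +ᶠ (d 1F *ᶠ y₁ +ᶠ 0#) ≈ 0# → ∀ k → d k ≈ 0#
  cramer nonsingular d eq₀ eq₁ 0F = cramerˡ nonsingular eq₀ eq₁
  cramer {x₀} {x₁} {y₀} {y₁} nonsingular d eq₀ eq₁ 1F =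
    -- The second coefficient becomes the first when the two rows are exchanged.
    cramerˡ (λ y₀x₁≈y₁x₀ → nonsingular (trans (*-comm x₀ y₁) (trans (sym y₀x₁≈y₁x₀) (*-comm y₀ x₁))))
      (trans (swap x₀ y₀) eq₀) (trans (swap x₁ y₁) eq₁)
    where
    swap : ∀ x y → d 1F *ᶠ y +ᶠ (d 0F *ᶠ x +ᶠ 0#) ≈ d 0F *ᶠ x +ᶠ (d 1F *ᶠ y +ᶠ 0#)
    swap x y = solve 4 (λ d e x y → e :* y :+ (d :* x :+ con 0) := d :* x :+ (e :* y :+ con 0))
      refl (d 0F) (d 1F) x y

  module _ (D : Matrix 4 2)
    (nonsingular : ∀ i j → i ≢ j → ¬ D i 0F *ᶠ D j 1F ≈ D i 1F *ᶠ D j 0F) where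

    rowPairs-independent : ∀ i j → i ≢ j → LinearlyIndependent (D i ∷ D j ∷ [])
    rowPairs-independent i j i≢j coeffs ≋0 =
      cramer (nonsingular i j i≢j) coeffs (≋0 0F) (≋0 1F)

    private
      G = transpose D

    -- Columns `i` and `j` of `G` form the transpose of rows `i` and `j` of `D`, so their
    -- determinant is the same minor.
    vanishing : ∀ {i j} → i ≢ j → ∀ coeffs →
      combination coeffs G i ≈ 0# → combination coeffs G j ≈ 0# → ∀ k → coeffs k ≈ 0#
    vanishing {i} {j} i≢j =
      cramer (λ eq → nonsingular i j i≢j (trans eq (*-comm (D j 0F) (D i 1F))))

    G-independent : LinearlyIndependent G
    G-independent coeffs ≋0 = vanishing {0F} {1F} (λ ()) coeffs (≋0 0F) (≋0 1F)

    G-isBasis : IsBasis G (span G)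
    G-isBasis = independent⇒basis G-independent

    -- The difference of the two words is zero at `i` and at `j`, so the coefficients of the two
    -- words coincide.
    span-determined : ∀ {x y} → span G x → span G y → ∀ {i j} → i ≢ j → x i ≈ y i → x j ≈ y j → x ≋ y
    span-determined {x} {y} (d , x≋d) (e , y≋e) {i} {j} i≢j xᵢ≈yᵢ xⱼ≈yⱼ k = begin
      x k                 ≈⟨ x≋d k ⟩
      combination d G k   ≈⟨ combination-cong G (λ m → x∙y⁻¹≈ε⇒x≈y (d m) (e m) (d≈e m)) k ⟩
      combination e G k   ≈⟨ y≋e k ⟨
      y k                 ∎
      where
      agree : ∀ {k} → x k ≈ y k → combination (λ m → d m -ᶠ e m) G k ≈ 0#
      agree {k} xₖ≈yₖ = identityˡ-unique _ (combination e G k) (begin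
        combination (λ m → d m -ᶠ e m) G k +ᶠ combination e G k
          ≈⟨ combination-+ (λ m → d m -ᶠ e m) e G k ⟨
        combination (λ m → d m -ᶠ e m +ᶠ e m) G k
          ≈⟨ combination-cong G (λ m → //-rightDividesˡ (e m) (d m)) k ⟩
        combination d G k   ≈⟨ x≋d k ⟨
        x k                 ≈⟨ xₖ≈yₖ ⟩
        y k                 ≈⟨ y≋e k ⟩
        combination e G k   ∎)

      d≈e : ∀ m → d m -ᶠ e m ≈ 0#
      d≈e = vanishing i≢j (λ m → d m -ᶠ e m) (agree xᵢ≈yᵢ) (agree xⱼ≈yⱼ)

    isMinimumDistance : HasMinimumDistance (span G) 3
    isMinimumDistance = record
      { lowerBound = λ {x} {y} x∈ y∈ x≉y →
          -- Distinct codewords agree in at most one of four coordinates: 4 ≤ 1 + distance, and one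
          -- successor is removed. Failing the filter is a double negation, which suffices because
          -- the goal is negative.
          ℕ.s≤s⁻¹ (length-filter-allPairs (λ i → ¬? (x i ≟ y i)) {allFin 4}
            (tabulate⁺ λ {i} {j} i≢j ¬¬xᵢ≈yᵢ xⱼ≈yⱼ → ¬¬xᵢ≈yᵢ λ xᵢ≈yᵢ →
              x≉y (span-determined x∈ y∈ i≢j xᵢ≈yᵢ xⱼ≈yⱼ)))
      ; attained = word , (λ _ → 0#) , (coeffs , λ _ → refl) , IsSubspace.0∈ (span-isSubspace G)
          , (λ word≋0 → word≉0 1F (λ ()) (word≋0 1F))
          , ≡.trans (≡.cong length (filter-reject differs? (λ word₀≉0 → word₀≉0 word₀≈0)))
                    (≡.cong length (filter-all differs? {1F List.∷ 2F List.∷ 3F List.∷ List.[]}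
                      (word≉0 1F (λ ()) All.∷ word≉0 2F (λ ()) All.∷ word≉0 3F (λ ()) All.∷ All.[])))
      }
      where
      -- Orthogonal to row 0 of `D`, so `word` vanishes at coordinate 0; its entry at `i` is, up to
      -- sign, the minor of rows 0 and `i`.
      coeffs : Vector Carrier 2
      coeffs = D 0F 1F ∷ -ᶠ D 0F 0F ∷ []

      word : Vector Carrier 4
      word = combination coeffs G

      differs? = λ i → ¬? (word i ≟ 0#)

      word-difference : ∀ i → word i ≈ D 0F 1F *ᶠ D i 0F -ᶠ D 0F 0F *ᶠ D i 1F
      word-difference i = +-congˡ (trans (+-identityʳ _) (sym (-‿distribˡ-* (D 0F 0F) (D i 1F))))

      word₀≈0 : word 0F ≈ 0#
      word₀≈0 = trans (word-difference 0F) (x≈y⇒x∙y⁻¹≈ε (*-comm (D 0F 1F) (D 0F 0F)))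

      word≉0 : ∀ i → 0F ≢ i → ¬ word i ≈ 0#
      word≉0 i 0≢i word≈0 = nonsingular 0F i 0≢i (sym (x∙y⁻¹≈ε⇒x≈y _ _
        (trans (sym (word-difference i)) word≈0)))

    span-isMDSCode : IsMDSCode 4 2 3 (span G)
    span-isMDSCode = record
      { isCode = record
          { isSubspace = span-isSubspace G
          ; dimension = G , G-isBasis
          ; minimumDistance = isMinimumDistance
          }
      ; mds = ≡.refl
      }

private module Solver = +-*-Solver
open Solver using (Polynomial; solve; con; var; _:=_; _:+_; _:*_; _:-_; :-_)

-- Reduction modulo p: a ring homomorphism from ℤ with kernel pℤ.

module Reduction {c ℓ} {p : ℕ} (pr : Prime p) {α : ℕ} (F : FiniteField (p ^ α) c ℓ) where
  open FieldNotation F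
  open FieldProperties F
  open Coding F using (reduce)
  open import Algebra.Properties.Semiring.Mult semiring
    using (×1-homo-*; ×-homo-+; ×-congˡ) renaming (_×_ to _·_)
  open import Algebra.Properties.Group +-group using (identityˡ-unique)
  open import Relation.Binary.Reasoning.Setoid setoid

  private instance
    p≢0 : NonZero p
    p≢0 = prime⇒nonZero pr

  ⟦_⟧ : ℤ → Carrier
  ⟦_⟧ = reduce p

  p·1≈0 : p · 1# ≈ 0#
  p·1≈0 = ^·1≈0⇒·1≈0 p α order·1≈0

  -≡*p⇒·1≈ : ∀ k m n → + m - + n ≡ + k * + p → m · 1# ≈ n · 1#
  -≡*p⇒·1≈ k m n m-n≡kp = begin
    m · 1#                         ≈⟨ ×-congˡ m≡n+kp ⟩
    (n ℕ.+ k ℕ.* p) · 1#           ≈⟨ ×-homo-+ 1# n (k ℕ.* p) ⟩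
    n · 1# +ᶠ (k ℕ.* p) · 1#       ≈⟨ +-congˡ (×1-homo-* k p) ⟩
    n · 1# +ᶠ (k · 1# *ᶠ p · 1#)   ≈⟨ +-congˡ (*-congˡ p·1≈0) ⟩
    n · 1# +ᶠ (k · 1# *ᶠ 0#)       ≈⟨ +-congˡ (zeroʳ (k · 1#)) ⟩
    n · 1# +ᶠ 0#                   ≈⟨ +-identityʳ (n · 1#) ⟩
    n · 1#                         ∎
    where
    m≡n+kp : m ≡ n ℕ.+ k ℕ.* p
    m≡n+kp = Int.+-injective (≡.trans
      (solve 2 (λ i j → i := j :+ (i :- j)) ≡.refl (+ m) (+ n))
      (≡.cong (λ i → + n + i) (≡.trans m-n≡kp (≡.sym (Int.pos-* k p)))))

  ∣-⇒·1≈ : ∀ m n → + p ∣ (+ m - + n) → m · 1# ≈ n · 1#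
  ∣-⇒·1≈ m n (divides (+ k)     m-n≡kp) = -≡*p⇒·1≈ k m n m-n≡kp
  -- A negative quotient becomes a natural one after exchanging `m` and `n`.
  ∣-⇒·1≈ m n (divides -[1+ k ] m-n≡-kp) = sym (-≡*p⇒·1≈ (suc k) n m (≡.trans
    (solve 2 (λ i j → j :- i := :- (i :- j)) ≡.refl (+ m) (+ n))
    (≡.trans (≡.cong -_ m-n≡-kp) (Int.neg-distribˡ-* -[1+ k ] (+ p)))))

  ∣-%ℕ : ∀ a → + p ∣ (a - + (a %ℕ p))
  ∣-%ℕ a = divides (a /ℕ p) (≡.trans
    (≡.cong (_- + (a %ℕ p)) (Int.a≡a%ℕn+[a/ℕn]*n a p))
    (solve 2 (λ r k → r :+ k :- r := k) ≡.refl (+ (a %ℕ p)) (a /ℕ p * + p)))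

  -- Any natural number in the class of `a` may replace its remainder. Sums and products of
  -- remainders need not be remainders, so the homomorphism laws rest on this.
  ∣-⇒⟦⟧≈·1 : ∀ a n → + p ∣ (a - + n) → ⟦ a ⟧ ≈ n · 1#
  ∣-⇒⟦⟧≈·1 a n p∣a-n = sym (∣-⇒·1≈ n (a %ℕ p) (≡.subst (+ p ∣_)
    (solve 3 (λ a r n → a :- r :+ :- (a :- n) := n :- r) ≡.refl a (+ (a %ℕ p)) (+ n))
    (∣m∣n⇒∣m+n (∣-%ℕ a) (∣m⇒∣-m p∣a-n))))

  ∣⇒⟦⟧≈0 : ∀ {a} → + p ∣ a → ⟦ a ⟧ ≈ 0#
  ∣⇒⟦⟧≈0 {a} p∣a = ∣-⇒⟦⟧≈·1 a 0 (≡.subst (+ p ∣_) (≡.sym (Int.+-identityʳ a)) p∣a)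

  ⟦⟧-homo-+ : ∀ a b → ⟦ a + b ⟧ ≈ ⟦ a ⟧ +ᶠ ⟦ b ⟧
  ⟦⟧-homo-+ a b = trans
    (∣-⇒⟦⟧≈·1 (a + b) (r ℕ.+ s) (≡.subst (+ p ∣_)
      (solve 4 (λ a b r s → a :- r :+ (b :- s) := a :+ b :- (r :+ s)) ≡.refl a b (+ r) (+ s))
      (∣m∣n⇒∣m+n (∣-%ℕ a) (∣-%ℕ b))))
    (×-homo-+ 1# r s)
    where r = a %ℕ p; s = b %ℕ p

  ⟦⟧-homo-* : ∀ a b → ⟦ a * b ⟧ ≈ ⟦ a ⟧ *ᶠ ⟦ b ⟧
  ⟦⟧-homo-* a b = trans
    (∣-⇒⟦⟧≈·1 (a * b) (r ℕ.* s) (≡.subst (+ p ∣_)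
      (≡.trans
        (solve 4 (λ a b r s → a :* (b :- s) :+ s :* (a :- r) := a :* b :- r :* s) ≡.refl a b (+ r) (+ s))
        (≡.cong (λ t → a * b - t) (≡.sym (Int.pos-* r s))))
      (∣m∣n⇒∣m+n (∣n⇒∣m*n a (∣-%ℕ b)) (∣n⇒∣m*n (+ s) (∣-%ℕ a)))))
    (×1-homo-* r s)
    where r = a %ℕ p; s = b %ℕ p

  ⟦-⟧≈0 : ∀ a b → ⟦ a ⟧ ≈ ⟦ b ⟧ → ⟦ a - b ⟧ ≈ 0#
  ⟦-⟧≈0 a b a≈b = identityˡ-unique ⟦ a - b ⟧ ⟦ b ⟧ (begin
    ⟦ a - b ⟧ +ᶠ ⟦ b ⟧  ≈⟨ ⟦⟧-homo-+ (a - b) b ⟨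
    ⟦ a - b + b ⟧       ≡⟨ ≡.cong ⟦_⟧ (solve 2 (λ a b → a :- b :+ b := a) ≡.refl a b) ⟩
    ⟦ a ⟧               ≈⟨ a≈b ⟩
    ⟦ b ⟧               ∎)

  -- A nonzero remainder is coprime to p; by Bézout, if its multiple of 1 vanished along with p · 1,
  -- then 1 = 0.
  ⟦⟧≈0⇒∣ : ∀ a → ⟦ a ⟧ ≈ 0# → + p ∣ a
  ⟦⟧≈0⇒∣ a a≈0 with a %ℕ p | Int.n%ℕd<d a p | ∣-%ℕ a
  ... | zero      | _   | p∣a-0 = ≡.subst (+ p ∣_) (Int.+-identityʳ a) p∣a-0
  ... | r@(suc _) | r<p | _     = contradiction 1≈0 1≉0
    where
    multiple≈0 : ∀ x {n} → n · 1# ≈ 0# → (x ℕ.* n) · 1# ≈ 0#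
    multiple≈0 x {n} n≈0 = trans (×1-homo-* x n) (trans (*-congˡ n≈0) (zeroʳ (x · 1#)))

    -- Over ℕ a Bézout identity comes in two sign patterns, both of the shape 1 + m = n with m and n
    -- vanishing in the field.
    bezout : ∀ {m n} → m · 1# ≈ 0# → n · 1# ≈ 0# → 1 ℕ.+ m ≡ n → 1# ≈ 0#
    bezout {m} {n} m≈0 n≈0 1+m≡n = begin
      1#              ≈⟨ +-identityʳ 1# ⟨
      1# +ᶠ 0#        ≈⟨ +-congˡ m≈0 ⟨
      (1 ℕ.+ m) · 1#  ≈⟨ ×-congˡ 1+m≡n ⟩
      n · 1#          ≈⟨ n≈0 ⟩
      0#              ∎

    1≈0 : 1# ≈ 0#
    1≈0 with ℕ.coprime-Bézout (ℕ.prime⇒coprime pr r<p)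
    ... | ℕ.Bézout.+- x y 1+yr≡xp = bezout (multiple≈0 y a≈0) (multiple≈0 x p·1≈0) 1+yr≡xp
    ... | ℕ.Bézout.-+ x y 1+xp≡yr = bezout (multiple≈0 x p·1≈0) (multiple≈0 y a≈0) 1+xp≡yr

-- Coordinates in ℤ[ζ] and the quadratic forms `tⱼ`.

∙-cong : ∀ {a a′ b b′ c c′ d d′} → a ≡ a′ → b ≡ b′ → c ≡ c′ → d ≡ d′ →
  (a ∙1+ b ∙ζ+ c ∙ζ²+ d ∙ζ³) ≡ (a′ ∙1+ b′ ∙ζ+ c′ ∙ζ²+ d′ ∙ζ³)
∙-cong ≡.refl ≡.refl ≡.refl ≡.refl = ≡.refl

fromℤ-⊛ : ∀ a w x y z → fromℤ a ⊛ (w ∙1+ x ∙ζ+ y ∙ζ²+ z ∙ζ³) ≡ (a * w ∙1+ a * x ∙ζ+ a * y ∙ζ²+ a * z ∙ζ³)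
fromℤ-⊛ a w x y z = ∙-cong
  -- Products with `+ 0` on the left compute to `+ 0`, so only literal zeros remain to be removed.
  (solve 1 (λ i → i :+ o :+ o := i) ≡.refl (a * w))
  (solve 1 (λ i → i :+ o :+ o :+ o := i) ≡.refl (a * x))
  (solve 1 (λ i → i :+ o :+ o :+ o := i) ≡.refl (a * y))
  (solve 1 (λ i → i :+ o :+ o :+ o :+ o := i) ≡.refl (a * z))
  where
  o : ∀ {n} → Polynomial n
  o = con (+ 0)

⊛-fromℤ : ∀ w x y z a → (w ∙1+ x ∙ζ+ y ∙ζ²+ z ∙ζ³) ⊛ fromℤ a ≡ (w * a ∙1+ x * a ∙ζ+ y * a ∙ζ²+ z * a ∙ζ³)
⊛-fromℤ w x y z a = ∙-cong
  (solve 5 (λ w x y z a → w :* a :+ (y :* o :+ z :* o) :- (x :* o :+ y :* o :+ z :* o) := w :* a) ≡.refl w x y z a)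
  (solve 5 (λ w x y z a → w :* o :+ x :* a :+ z :* o :- (x :* o :+ y :* o :+ z :* o) := x :* a) ≡.refl w x y z a)
  (solve 5 (λ w x y z a → w :* o :+ x :* o :+ y :* a :- (x :* o :+ y :* o :+ z :* o) := y :* a) ≡.refl w x y z a)
  (solve 5 (λ w x y z a → w :* o :+ x :* o :+ y :* o :+ z :* a :- (x :* o :+ y :* o :+ z :* o) := z :* a) ≡.refl w x y z a)
  where
  o : ∀ {n} → Polynomial n
  o = con (+ 0)

-- The four integer quotients are the coordinates of the quotient in ℤ[ζ]. Needed to contradict (v).
fromℤ-∣ : ∀ {m w x y z} → m ∣ w → m ∣ x → m ∣ y → m ∣ z →
  fromℤ m ℤ[ζ]-Ring.∣ (w ∙1+ x ∙ζ+ y ∙ζ²+ z ∙ζ³)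
fromℤ-∣ {m} (divides w ≡.refl) (divides x ≡.refl) (divides y ≡.refl) (divides z ≡.refl) =
  (w ∙1+ x ∙ζ+ y ∙ζ²+ z ∙ζ³) , ⊛-fromℤ w x y z m

-- Abstract operations, so that the same forms can be read over ℤ and as polynomials of the solver.
-- t₀ is invariant modulo Q₂ under Gal(ℚ(ζ)/ℚ), which permutes the aᵢ, and t₁, …, t₄ are conjugate.
module Forms {A : Set} (plus minus times : A → A → A) (a₁ a₂ a₃ a₄ : A) where
  private
    infixl 6 _⊹_ _⊸_
    infixl 7 _✶_
    _⊹_ = plus
    _⊸_ = minus
    _✶_ = times

    orbit : A → A → A → A → A
    orbit w x y z = w ✶ x ⊹ x ✶ y ⊸ x ✶ x ⊸ w ✶ z

  Q₁ Q₂ t₀ t₁ t₂ t₃ t₄ : A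
  Q₁ = a₁ ✶ a₁ ⊹ a₂ ✶ a₂ ⊹ a₃ ✶ a₃ ⊹ a₄ ✶ a₄ ⊸ (a₁ ✶ a₂ ⊹ a₂ ✶ a₃ ⊹ a₃ ✶ a₄)
  Q₂ = a₁ ✶ a₂ ⊹ a₂ ✶ a₃ ⊹ a₃ ✶ a₄ ⊸ (a₁ ✶ a₃ ⊹ a₂ ✶ a₄ ⊹ a₁ ✶ a₄)
  t₀ = a₂ ✶ a₃ ⊸ a₂ ✶ a₄ ⊸ a₁ ✶ a₃
  t₁ = orbit a₂ a₄ a₁ a₃
  t₂ = orbit a₄ a₃ a₂ a₁
  t₃ = orbit a₁ a₂ a₃ a₄
  t₄ = orbit a₃ a₁ a₄ a₂

-- Polynomial identities modulo `Q₁` and `Q₂`.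

module Identities (a₁ a₂ a₃ a₄ : ℤ) where
  open Forms _+_ _-_ _*_ a₁ a₂ a₃ a₄ public

  infix 4 _∼_

  -- `H` times its complex conjugate is `Q₁` - `Q₂` (ζ² + ζ³), so (i) and (ii) make `Q₁` = q and
  -- `Q₂` = 0, and this relation then implies congruence modulo p.
  record _∼_ (x y : ℤ) : Set where
    constructor mod-Q
    field
      B C      : ℤ
      equality : x ≡ y + (B * Q₁ + C * Q₂)

  private
    X₁ X₂ X₃ X₄ 0ᵖ 1ᵖ 2ᵖ : Polynomial 4
    X₁ = var 0F
    X₂ = var 1F
    X₃ = var 2F
    X₄ = var 3F
    0ᵖ = con (+ 0)
    1ᵖ = con (+ 1)
    2ᵖ = con (+ 2)

    module P = Forms _:+_ _:-_ _:*_ X₁ X₂ X₃ X₄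

    ρ : Vec ℤ 4
    ρ = a₁ Vec.∷ a₂ Vec.∷ a₃ Vec.∷ a₄ Vec.∷ Vec.[]

    -- The last argument compares normal forms of the solver, so for explicit polynomials it is
    -- `refl`.
    prove-∼ : ∀ x y B C →
      Solver.⟦ x ⟧↓ ρ ≡ Solver.⟦ y :+ (B :* P.Q₁ :+ C :* P.Q₂) ⟧↓ ρ →
      Solver.⟦ x ⟧ ρ ∼ Solver.⟦ y ⟧ ρ
    prove-∼ x y B C = mod-Q (Solver.⟦ B ⟧ ρ) (Solver.⟦ C ⟧ ρ) ∘
      Solver.prove ρ x (y :+ (B :* P.Q₁ :+ C :* P.Q₂))

  ∑t≡-Q₁ : t₀ + t₁ + t₂ + t₃ + t₄ ≡ - Q₁
  ∑t≡-Q₁ = Solver.prove ρ (P.t₀ :+ P.t₁ :+ P.t₂ :+ P.t₃ :+ P.t₄) (:- P.Q₁) ≡.refl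

  -- The cofactors of Q₁ and Q₂ below are solutions of linear systems for their coefficients.

  t₁t₁∼t₀t₂ : t₁ * t₁ ∼ t₀ * t₂
  t₁t₁∼t₀t₂ = prove-∼ (P.t₁ :* P.t₁) (P.t₀ :* P.t₂)
    (X₄ :* X₄ :- X₃ :* X₄) (X₃ :* X₃ :- 2ᵖ :* X₃ :* X₄ :+ 2ᵖ :* X₄ :* X₄) ≡.refl

  t₂t₂∼t₀t₄ : t₂ * t₂ ∼ t₀ * t₄
  t₂t₂∼t₀t₄ = prove-∼ (P.t₂ :* P.t₂) (P.t₀ :* P.t₄)
    (X₃ :* X₃ :- X₁ :* X₃) (X₂ :* X₃ :- X₁ :* X₄ :- X₃ :* X₃) ≡.refl

  t₃t₃∼t₀t₁ : t₃ * t₃ ∼ t₀ * t₁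
  t₃t₃∼t₀t₁ = prove-∼ (P.t₃ :* P.t₃) (P.t₀ :* P.t₁)
    (X₂ :* X₂ :- X₂ :* X₄) (X₂ :* X₃ :- X₁ :* X₄ :- X₂ :* X₂) ≡.refl

  t₄t₄∼t₀t₃ : t₄ * t₄ ∼ t₀ * t₃
  t₄t₄∼t₀t₃ = prove-∼ (P.t₄ :* P.t₄) (P.t₀ :* P.t₃)
    (X₁ :* X₁ :- X₁ :* X₂) (2ᵖ :* X₁ :* X₁ :- 2ᵖ :* X₁ :* X₂ :+ X₂ :* X₂) ≡.refl

  t₁t₂∼t₀t₃ : t₁ * t₂ ∼ t₀ * t₃
  t₁t₂∼t₀t₃ = prove-∼ (P.t₁ :* P.t₂) (P.t₀ :* P.t₃)
    (X₂ :* X₃ :- X₂ :* X₄) (X₁ :* X₄ :- X₂ :* X₃ :+ X₃ :* X₄ :- X₄ :* X₄) ≡.refl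

  t₂t₃∼t₀t₀ : t₂ * t₃ ∼ t₀ * t₀
  t₂t₃∼t₀t₀ = prove-∼ (P.t₂ :* P.t₃) (P.t₀ :* P.t₀)
    (:- (X₂ :* X₃)) (X₁ :* X₃ :- X₁ :* X₄ :+ X₂ :* X₄) ≡.refl

  t₃t₄∼t₀t₂ : t₃ * t₄ ∼ t₀ * t₂
  t₃t₄∼t₀t₂ = prove-∼ (P.t₃ :* P.t₄) (P.t₀ :* P.t₂)
    (X₂ :* X₃ :- X₁ :* X₃) (X₁ :* X₂ :- X₁ :* X₁ :+ X₁ :* X₄ :- X₂ :* X₃) ≡.refl

  -- Of the six minors, those for rows 02, 12 and 13 equal a single form exactly; the other three
  -- are sums of two forms only up to `Q₁` and `Q₂`.
  minor₀₁ : (a₁ - a₂ + a₃) * a₃ - a₄ * (a₃ - a₄) ∼ t₃ + t₄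
  minor₀₁ = prove-∼ ((X₁ :- X₂ :+ X₃) :* X₃ :- X₄ :* (X₃ :- X₄)) (P.t₃ :+ P.t₄) 1ᵖ 0ᵖ ≡.refl

  minor₀₂ : (a₁ - a₂ + a₃) * a₂ - a₄ * a₁ ∼ t₃
  minor₀₂ = prove-∼ ((X₁ :- X₂ :+ X₃) :* X₂ :- X₄ :* X₁) P.t₃ 0ᵖ 0ᵖ ≡.refl

  minor₀₃ : (a₁ - a₂ + a₃) * a₁ - a₄ * (a₁ - a₂ + a₃ - a₄) ∼ t₂ + t₃
  minor₀₃ = prove-∼ ((X₁ :- X₂ :+ X₃) :* X₁ :- X₄ :* (X₁ :- X₂ :+ X₃ :- X₄)) (P.t₂ :+ P.t₃)
    1ᵖ (:- 1ᵖ) ≡.refl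

  minor₁₂ : (a₃ - a₄) * a₂ - a₃ * a₁ ∼ t₀
  minor₁₂ = prove-∼ ((X₃ :- X₄) :* X₂ :- X₃ :* X₁) P.t₀ 0ᵖ 0ᵖ ≡.refl

  minor₁₃ : (a₃ - a₄) * a₁ - a₃ * (a₁ - a₂ + a₃ - a₄) ∼ t₂
  minor₁₃ = prove-∼ ((X₃ :- X₄) :* X₁ :- X₃ :* (X₁ :- X₂ :+ X₃ :- X₄)) P.t₂ 0ᵖ 0ᵖ ≡.refl

  minor₂₃ : a₁ * a₁ - a₂ * (a₁ - a₂ + a₃ - a₄) ∼ t₁ + t₂
  minor₂₃ = prove-∼ (X₁ :* X₁ :- X₂ :* (X₁ :- X₂ :+ X₃ :- X₄)) (P.t₁ :+ P.t₂) 1ᵖ 0ᵖ ≡.refl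

  Q₁≡ : ∀ {q} →
    + q / 1 ≃ (a₁ * a₁ + a₂ * a₂ + a₃ * a₃ + a₄ * a₄) / 1
      -ℚ ½ *ℚ ((a₁ * a₂ + a₂ * a₃ + a₃ * a₄ + a₁ * a₃ + a₂ * a₄ + a₁ * a₄) / 1) →
    a₁ * a₂ + a₂ * a₃ + a₃ * a₄ ≡ a₁ * a₃ + a₂ * a₄ + a₁ * a₄ →
    Q₁ ≡ + q
  Q₁≡ {q} i ii = Int.*-cancelʳ-≡ Q₁ (+ q) (+ 2) (≡.trans (≡.trans
    -- Doubling clears ½. The factors 1 and 2 reproduce the numerator that unnormalised rational
    -- arithmetic produces in (i).
    (Solver.prove ρ (P.Q₁ :* 2ᵖ)
      (((X₁ :* X₁ :+ X₂ :* X₂ :+ X₃ :* X₃ :+ X₄ :* X₄) :* 2ᵖ :+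
        (:- (1ᵖ :* (X₁ :* X₂ :+ X₂ :* X₃ :+ X₃ :* X₄ :+ X₁ :* X₃ :+ X₂ :* X₄ :+ X₁ :* X₄))) :* 1ᵖ)
       :* 1ᵖ :- P.Q₂)
      ≡.refl)
    (≡.cong₂ _-_ (≡.sym (drop-*≡* i)) (Int.i≡j⇒i-j≡0 ii)))
    (Int.+-identityʳ (+ q * + 2)))

  -- Substituting ζ⁴ = - 1 - ζ - ζ² - ζ³ spreads - a₄ over all coordinates.
  H≡ : H a₁ a₂ a₃ a₄ ≡ ((- a₄) ∙1+ (a₁ - a₄) ∙ζ+ (a₂ - a₄) ∙ζ²+ (a₃ - a₄) ∙ζ³)
  H≡ = ≡.trans
    (≡.cong₂ _⊕_ (≡.cong₂ _⊕_ (≡.cong₂ _⊕_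
      (fromℤ-⊛ a₁ (+ 0) (+ 1) (+ 0) (+ 0))
      (fromℤ-⊛ a₂ (+ 0) (+ 0) (+ 1) (+ 0)))
      (fromℤ-⊛ a₃ (+ 0) (+ 0) (+ 0) (+ 1)))
      (fromℤ-⊛ a₄ -[1+ 0 ] -[1+ 0 ] -[1+ 0 ] -[1+ 0 ]))
    (∙-cong
      (Solver.prove ρ (X₁ :* 0ᵖ :+ X₂ :* 0ᵖ :+ X₃ :* 0ᵖ :+ X₄ :* -1ᵖ) (:- X₄)    ≡.refl)
      (Solver.prove ρ (X₁ :* 1ᵖ :+ X₂ :* 0ᵖ :+ X₃ :* 0ᵖ :+ X₄ :* -1ᵖ) (X₁ :- X₄) ≡.refl)
      (Solver.prove ρ (X₁ :* 0ᵖ :+ X₂ :* 1ᵖ :+ X₃ :* 0ᵖ :+ X₄ :* -1ᵖ) (X₂ :- X₄) ≡.refl)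
      (Solver.prove ρ (X₁ :* 0ᵖ :+ X₂ :* 0ᵖ :+ X₃ :* 1ᵖ :+ X₄ :* -1ᵖ) (X₃ :- X₄) ≡.refl))
    where
    -1ᵖ : Polynomial 4
    -1ᵖ = con -[1+ 0 ]

  -- The product is - (t₀ + t₃ ζ + t₁ ζ² + t₄ ζ³ + t₂ ζ⁴) - `Q₂` (ζ² + ζ³); eliminating ζ⁴ adds `t₂`
  -- to each coordinate.
  H⊛σ₂H≡ : H a₁ a₂ a₃ a₄ ⊛ σ₂ (H a₁ a₂ a₃ a₄) ≡
    ((t₂ - t₀) ∙1+ (t₂ - t₃) ∙ζ+ (t₂ - t₁ - Q₂) ∙ζ²+ (t₂ - t₄ - Q₂) ∙ζ³)
  H⊛σ₂H≡ = ≡.trans (≡.cong (λ h → h ⊛ σ₂ h) H≡) (∙-cong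
    (Solver.prove ρ (w :* (w :- y) :+ (y :* (:- y) :+ z :* (x :- y)) :- ζ⁴) (P.t₂ :- P.t₀) ≡.refl)
    (Solver.prove ρ (w :* (z :- y) :+ x :* (w :- y) :+ z :* (:- y) :- ζ⁴) (P.t₂ :- P.t₃) ≡.refl)
    (Solver.prove ρ (w :* (x :- y) :+ x :* (z :- y) :+ y :* (w :- y) :- ζ⁴)
      (P.t₂ :- P.t₁ :- P.Q₂) ≡.refl)
    (Solver.prove ρ (w :* (:- y) :+ x :* (x :- y) :+ y :* (z :- y) :+ z :* (w :- y) :- ζ⁴)
      (P.t₂ :- P.t₄ :- P.Q₂) ≡.refl))
    where
    w x y z ζ⁴ : Polynomial 4
    w = :- X₄
    x = X₁ :- X₄
    y = X₂ :- X₄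
    z = X₃ :- X₄
    -- The coefficient of ζ⁴ in the unreduced product, not the power itself.
    ζ⁴ = x :* (:- y) :+ y :* (x :- y) :+ z :* (z :- y)

-- Field elements that multiply like multiples of fifth roots of unity.

module _ {q c ℓ} (F : FiniteField q c ℓ) where
  open FieldNotation F
  open FieldProperties F
  open import Algebra.Solver.CommutativeMonoid +-commutativeMonoid
    using () renaming (solve to +-solve; _⊕_ to infixl 6 _⊹_; _⊜_ to infix 4 _⊜_)
  open import Relation.Binary.Reasoning.Setoid setoid

  +≈0 : ∀ {x y} → x ≈ 0# → y ≈ 0# → x +ᶠ y ≈ 0#
  +≈0 x≈0 y≈0 = trans (+-cong x≈0 y≈0) (+-identityˡ 0#)

  -- The product hypotheses are instances of τⱼ τₖ = τ₀ τⱼ₊ₖ with indices modulo 5; the root ω is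
  -- never constructed.
  module Cyclic {τ₀ τ₁ τ₂ τ₃ τ₄}
    (sum≈0 : τ₀ +ᶠ τ₁ +ᶠ τ₂ +ᶠ τ₃ +ᶠ τ₄ ≈ 0#)
    (τ₁τ₁ : τ₁ *ᶠ τ₁ ≈ τ₀ *ᶠ τ₂) (τ₂τ₂ : τ₂ *ᶠ τ₂ ≈ τ₀ *ᶠ τ₄)
    (τ₃τ₃ : τ₃ *ᶠ τ₃ ≈ τ₀ *ᶠ τ₁) (τ₄τ₄ : τ₄ *ᶠ τ₄ ≈ τ₀ *ᶠ τ₃)
    (τ₁τ₂ : τ₁ *ᶠ τ₂ ≈ τ₀ *ᶠ τ₃) (τ₂τ₃ : τ₂ *ᶠ τ₃ ≈ τ₀ *ᶠ τ₀)
    (τ₃τ₄ : τ₃ *ᶠ τ₄ ≈ τ₀ *ᶠ τ₂)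
    (not-all-zero : ¬ (τ₀ ≈ 0# × τ₁ ≈ 0# × τ₂ ≈ 0# × τ₃ ≈ 0# × τ₄ ≈ 0#))
    where

    -- Each square τⱼ² is a multiple of `τ₀`, so `τ₀` = 0 would make all five vanish.
    τ₀≉0 : ¬ τ₀ ≈ 0#
    τ₀≉0 τ₀≈0 = not-all-zero
      (τ₀≈0 , vanishes τ₁τ₁ , vanishes τ₂τ₂ , vanishes τ₃τ₃ , vanishes τ₄τ₄)
      where
      vanishes : ∀ {x y} → x *ᶠ x ≈ τ₀ *ᶠ y → x ≈ 0#
      vanishes {y = y} xx≈τ₀y = square≈0⇒≈0 (trans xx≈τ₀y (trans (*-congʳ τ₀≈0) (zeroˡ y)))

    -- Both `τ₂` and `τ₃` are factors of τ₀².
    τ₂≉0 : ¬ τ₂ ≈ 0#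
    τ₂≉0 τ₂≈0 = τ₀≉0 (square≈0⇒≈0 (trans (sym τ₂τ₃) (trans (*-congʳ τ₂≈0) (zeroˡ τ₃))))

    τ₃≉0 : ¬ τ₃ ≈ 0#
    τ₃≉0 τ₃≈0 = τ₀≉0 (square≈0⇒≈0 (trans (sym τ₂τ₃) (trans (*-congˡ τ₃≈0) (zeroʳ τ₂))))

    -- Multiplying a relation x + y = 0 by a suitable z shifts the indices of x and y.
    shift : ∀ {x y z x′ y′} → z *ᶠ x ≈ τ₀ *ᶠ x′ → z *ᶠ y ≈ τ₀ *ᶠ y′ → x +ᶠ y ≈ 0# → x′ +ᶠ y′ ≈ 0#
    shift {x} {y} {z} {x′} {y′} zx≈τ₀x′ zy≈τ₀y′ x+y≈0 = ≉0∧*≈0⇒≈0 τ₀≉0 (begin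
      τ₀ *ᶠ (x′ +ᶠ y′)         ≈⟨ distribˡ τ₀ x′ y′ ⟩
      τ₀ *ᶠ x′ +ᶠ τ₀ *ᶠ y′     ≈⟨ +-cong zx≈τ₀x′ zy≈τ₀y′ ⟨
      z *ᶠ x +ᶠ z *ᶠ y         ≈⟨ distribˡ z x y ⟨
      z *ᶠ (x +ᶠ y)            ≈⟨ *-congˡ x+y≈0 ⟩
      z *ᶠ 0#                  ≈⟨ zeroʳ z ⟩
      0#                       ∎)

    private
      τ₁+τ₂≈0∧τ₃+τ₄≈0⇒⊥ : τ₁ +ᶠ τ₂ ≈ 0# → ¬ τ₃ +ᶠ τ₄ ≈ 0#
      τ₁+τ₂≈0∧τ₃+τ₄≈0⇒⊥ τ₁+τ₂≈0 τ₃+τ₄≈0 = τ₀≉0 (begin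
        τ₀                                    ≈⟨ +-identityʳ τ₀ ⟨
        τ₀ +ᶠ 0#                              ≈⟨ +-congˡ (+≈0 τ₁+τ₂≈0 τ₃+τ₄≈0) ⟨
        τ₀ +ᶠ ((τ₁ +ᶠ τ₂) +ᶠ (τ₃ +ᶠ τ₄))      ≈⟨ +-solve 5 (λ a b c d e →
                                                   a ⊹ (b ⊹ c ⊹ (d ⊹ e)) ⊜ a ⊹ b ⊹ c ⊹ d ⊹ e)
                                                 refl τ₀ τ₁ τ₂ τ₃ τ₄ ⟩
        τ₀ +ᶠ τ₁ +ᶠ τ₂ +ᶠ τ₃ +ᶠ τ₄            ≈⟨ sum≈0 ⟩
        0#                                    ∎)

    -- Multiplication by `τ₂` shifts indices by 2, so τ₃ + τ₄ would vanish as well, and the total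
    -- sum would leave `τ₀` = 0.
    τ₁+τ₂≉0 : ¬ τ₁ +ᶠ τ₂ ≈ 0#
    τ₁+τ₂≉0 τ₁+τ₂≈0 = τ₁+τ₂≈0∧τ₃+τ₄≈0⇒⊥ τ₁+τ₂≈0
      (shift (trans (*-comm τ₂ τ₁) τ₁τ₂) τ₂τ₂ τ₁+τ₂≈0)

    τ₃+τ₄≉0 : ¬ τ₃ +ᶠ τ₄ ≈ 0#
    τ₃+τ₄≉0 τ₃+τ₄≈0 = τ₁+τ₂≈0∧τ₃+τ₄≈0⇒⊥ (shift τ₃τ₃ τ₃τ₄ τ₃+τ₄≈0) τ₃+τ₄≈0

    -- The shift by 2 gives τ₄ + τ₀ = 0; the total sum then leaves `τ₁` = 0, which forces τ₃² = τ₀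
    -- τ₁ = 0.
    τ₂+τ₃≉0 : ¬ τ₂ +ᶠ τ₃ ≈ 0#
    τ₂+τ₃≉0 τ₂+τ₃≈0 = τ₃≉0 (square≈0⇒≈0 (trans τ₃τ₃ (trans (*-congˡ τ₁≈0) (zeroʳ τ₀))))
      where
      τ₄+τ₀≈0 : τ₄ +ᶠ τ₀ ≈ 0#
      τ₄+τ₀≈0 = shift τ₂τ₂ τ₂τ₃ τ₂+τ₃≈0

      τ₁≈0 : τ₁ ≈ 0#
      τ₁≈0 = begin
        τ₁                                  ≈⟨ +-identityʳ τ₁ ⟨
        τ₁ +ᶠ 0#                            ≈⟨ +-congˡ (+≈0 τ₂+τ₃≈0 τ₄+τ₀≈0) ⟨
        τ₁ +ᶠ ((τ₂ +ᶠ τ₃) +ᶠ (τ₄ +ᶠ τ₀))    ≈⟨ +-solve 5 (λ a b c d e →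
                                                 b ⊹ (c ⊹ d ⊹ (e ⊹ a)) ⊜ a ⊹ b ⊹ c ⊹ d ⊹ e)
                                               refl τ₀ τ₁ τ₂ τ₃ τ₄ ⟩
        τ₀ +ᶠ τ₁ +ᶠ τ₂ +ᶠ τ₃ +ᶠ τ₄          ≈⟨ sum≈0 ⟩
        0#                                  ∎

<-pairs : ∀ {ℓ} {P : Fin 4 → Fin 4 → Set ℓ} → P 0F 1F → P 0F 2F → P 0F 3F → P 1F 2F → P 1F 3F → P 2F 3F →
  ∀ {i j} → i Fin.< j → P i j
<-pairs p₀₁ p₀₂ p₀₃ p₁₂ p₁₃ p₂₃ {0F} {1F} _ = p₀₁
<-pairs p₀₁ p₀₂ p₀₃ p₁₂ p₁₃ p₂₃ {0F} {2F} _ = p₀₂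
<-pairs p₀₁ p₀₂ p₀₃ p₁₂ p₁₃ p₂₃ {0F} {3F} _ = p₀₃
<-pairs p₀₁ p₀₂ p₀₃ p₁₂ p₁₃ p₂₃ {1F} {2F} _ = p₁₂
<-pairs p₀₁ p₀₂ p₀₃ p₁₂ p₁₃ p₂₃ {1F} {3F} _ = p₁₃
<-pairs p₀₁ p₀₂ p₀₃ p₁₂ p₁₃ p₂₃ {2F} {3F} _ = p₂₃
<-pairs p₀₁ p₀₂ p₀₃ p₁₂ p₁₃ p₂₃ {suc _} {1F} (s<s ())
<-pairs p₀₁ p₀₂ p₀₃ p₁₂ p₁₃ p₂₃ {suc (suc _)} {2F} (s<s (s<s ()))
<-pairs p₀₁ p₀₂ p₀₃ p₁₂ p₁₃ p₂₃ {3F} {3F} (s<s (s<s (s<s ())))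

m∣m^n : ∀ m {n} → 1 ≤ n → m ℕ.∣ m ^ n
m∣m^n m {suc n} _ = ℕ.m∣m*n (m ^ n)

-- Nonvanishing of the six minors of `D`, and the theorem.

module MinorsNonzero {c ℓ} {p : ℕ} (pr : Prime p) {α : ℕ} (1≤α : 1 ≤ α) (F : FiniteField (p ^ α) c ℓ)
  (a₁ a₂ a₃ a₄ : ℤ)
  (i : + (p ^ α) / 1 ≃ (a₁ * a₁ + a₂ * a₂ + a₃ * a₃ + a₄ * a₄) / 1
    -ℚ ½ *ℚ ((a₁ * a₂ + a₂ * a₃ + a₃ * a₄ + a₁ * a₃ + a₂ * a₄ + a₁ * a₄) / 1))
  (ii : a₁ * a₂ + a₂ * a₃ + a₃ * a₄ ≡ a₁ * a₃ + a₂ * a₄ + a₁ * a₄)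
  (v : ¬ (fromℤ (+ p) ℤ[ζ]-Ring.∣ (H a₁ a₂ a₃ a₄ ℤ[ζ]-Ring.* σ₂ (H a₁ a₂ a₃ a₄))))
  where
  open Identities a₁ a₂ a₃ a₄
  open FieldNotation F
  open Coding F using (Matrix; matrixD)
  open Reduction pr {α} F
  open import Relation.Binary.Reasoning.Setoid setoid

  -- `Q₁` equals p ^ α, and α ≥ 1 provides a factor p.
  p∣Q₁ : + p ∣ Q₁
  p∣Q₁ = ≡.subst (+ p ∣_) (≡.sym (Q₁≡ i ii)) (∣ᵤ⇒∣ (m∣m^n p 1≤α))

  p∣Q₂ : + p ∣ Q₂
  p∣Q₂ = divides (+ 0) (Int.i≡j⇒i-j≡0 ii)

  ⟦⟧-cong-∼ : ∀ {x y} → x ∼ y → ⟦ x ⟧ ≈ ⟦ y ⟧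
  ⟦⟧-cong-∼ {x} {y} (mod-Q B C x≡y+BQ₁+CQ₂) = begin
    ⟦ x ⟧                             ≡⟨ ≡.cong ⟦_⟧ x≡y+BQ₁+CQ₂ ⟩
    ⟦ y + (B * Q₁ + C * Q₂) ⟧         ≈⟨ ⟦⟧-homo-+ y (B * Q₁ + C * Q₂) ⟩
    ⟦ y ⟧ +ᶠ ⟦ B * Q₁ + C * Q₂ ⟧      ≈⟨ +-congˡ (∣⇒⟦⟧≈0 p∣BQ₁+CQ₂) ⟩
    ⟦ y ⟧ +ᶠ 0#                       ≈⟨ +-identityʳ ⟦ y ⟧ ⟩
    ⟦ y ⟧                             ∎
    where
    p∣BQ₁+CQ₂ : + p ∣ (B * Q₁ + C * Q₂)
    p∣BQ₁+CQ₂ = ∣m∣n⇒∣m+n (∣n⇒∣m*n B p∣Q₁) (∣n⇒∣m*n C p∣Q₂)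

  ⟦⟧-product : ∀ x y z w → x * y ∼ z * w → ⟦ x ⟧ *ᶠ ⟦ y ⟧ ≈ ⟦ z ⟧ *ᶠ ⟦ w ⟧
  ⟦⟧-product x y z w xy∼zw = begin
    ⟦ x ⟧ *ᶠ ⟦ y ⟧  ≈⟨ ⟦⟧-homo-* x y ⟨
    ⟦ x * y ⟧       ≈⟨ ⟦⟧-cong-∼ xy∼zw ⟩
    ⟦ z * w ⟧       ≈⟨ ⟦⟧-homo-* z w ⟩
    ⟦ z ⟧ *ᶠ ⟦ w ⟧  ∎

  not-all-zero : ¬ (⟦ t₀ ⟧ ≈ 0# × ⟦ t₁ ⟧ ≈ 0# × ⟦ t₂ ⟧ ≈ 0# × ⟦ t₃ ⟧ ≈ 0# × ⟦ t₄ ⟧ ≈ 0#)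
  not-all-zero (t₀≈0 , t₁≈0 , t₂≈0 , t₃≈0 , t₄≈0) = v (≡.subst (fromℤ (+ p) ℤ[ζ]-Ring.∣_)
    (≡.sym H⊛σ₂H≡)
    (fromℤ-∣ (p∣t₂- t₀ t₀≈0) (p∣t₂- t₃ t₃≈0) (p∣t₂- t₁ t₁≈0 -Q₂) (p∣t₂- t₄ t₄≈0 -Q₂)))
    where
    p∣t₂- : ∀ x → ⟦ x ⟧ ≈ 0# → + p ∣ (t₂ - x)
    p∣t₂- x x≈0 = ∣m∣n⇒∣m-n (⟦⟧≈0⇒∣ t₂ t₂≈0) (⟦⟧≈0⇒∣ x x≈0)

    _-Q₂ : ∀ {x} → + p ∣ x → + p ∣ (x - Q₂)
    p∣x -Q₂ = ∣m∣n⇒∣m-n p∣x p∣Q₂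

  sum≈0 : ⟦ t₀ ⟧ +ᶠ ⟦ t₁ ⟧ +ᶠ ⟦ t₂ ⟧ +ᶠ ⟦ t₃ ⟧ +ᶠ ⟦ t₄ ⟧ ≈ 0#
  sum≈0 = begin
    ⟦ t₀ ⟧ +ᶠ ⟦ t₁ ⟧ +ᶠ ⟦ t₂ ⟧ +ᶠ ⟦ t₃ ⟧ +ᶠ ⟦ t₄ ⟧  ≈⟨ +-congʳ (+-congʳ (+-congʳ (⟦⟧-homo-+ t₀ t₁))) ⟨
    ⟦ t₀ + t₁ ⟧ +ᶠ ⟦ t₂ ⟧ +ᶠ ⟦ t₃ ⟧ +ᶠ ⟦ t₄ ⟧       ≈⟨ +-congʳ (+-congʳ (⟦⟧-homo-+ (t₀ + t₁) t₂)) ⟨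
    ⟦ t₀ + t₁ + t₂ ⟧ +ᶠ ⟦ t₃ ⟧ +ᶠ ⟦ t₄ ⟧            ≈⟨ +-congʳ (⟦⟧-homo-+ (t₀ + t₁ + t₂) t₃) ⟨
    ⟦ t₀ + t₁ + t₂ + t₃ ⟧ +ᶠ ⟦ t₄ ⟧                 ≈⟨ ⟦⟧-homo-+ (t₀ + t₁ + t₂ + t₃) t₄ ⟨
    ⟦ t₀ + t₁ + t₂ + t₃ + t₄ ⟧                      ≈⟨ ∣⇒⟦⟧≈0 (≡.subst (+ p ∣_) (≡.sym ∑t≡-Q₁) (∣m⇒∣-m p∣Q₁)) ⟩
    0#                                              ∎

  open Cyclic F sum≈0
    (⟦⟧-product t₁ t₁ t₀ t₂ t₁t₁∼t₀t₂) (⟦⟧-product t₂ t₂ t₀ t₄ t₂t₂∼t₀t₄)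
    (⟦⟧-product t₃ t₃ t₀ t₁ t₃t₃∼t₀t₁) (⟦⟧-product t₄ t₄ t₀ t₃ t₄t₄∼t₀t₃)
    (⟦⟧-product t₁ t₂ t₀ t₃ t₁t₂∼t₀t₃) (⟦⟧-product t₂ t₃ t₀ t₀ t₂t₃∼t₀t₀)
    (⟦⟧-product t₃ t₄ t₀ t₂ t₃t₄∼t₀t₂) not-all-zero

  D : Matrix 4 2
  D = matrixD p {{prime⇒nonZero pr}} a₁ a₂ a₃ a₄

  Nonsingular : Fin 4 → Fin 4 → Set ℓ
  Nonsingular i j = ¬ D i 0F *ᶠ D j 1F ≈ D i 1F *ᶠ D j 0F

  minor≉0 : ∀ x y z w {t} → x * w - y * z ∼ t → ¬ ⟦ t ⟧ ≈ 0# → ¬ ⟦ x ⟧ *ᶠ ⟦ w ⟧ ≈ ⟦ y ⟧ *ᶠ ⟦ z ⟧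
  minor≉0 x y z w {t} xw-yz∼t t≉0 xw≈yz = t≉0 (begin
    ⟦ t ⟧              ≈⟨ ⟦⟧-cong-∼ xw-yz∼t ⟨
    ⟦ x * w - y * z ⟧  ≈⟨ ⟦-⟧≈0 (x * w) (y * z)
                            (trans (⟦⟧-homo-* x w) (trans xw≈yz (sym (⟦⟧-homo-* y z)))) ⟩
    0#                 ∎)

  +≉0 : ∀ x y → ¬ ⟦ x ⟧ +ᶠ ⟦ y ⟧ ≈ 0# → ¬ ⟦ x + y ⟧ ≈ 0#
  +≉0 x y x+y≉0 x+y≈0 = x+y≉0 (trans (sym (⟦⟧-homo-+ x y)) x+y≈0)

  nonsingular-< : ∀ {i j} → i Fin.< j → Nonsingular i j
  nonsingular-< = <-pairs {P = Nonsingular}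
    (minor≉0 (a₁ - a₂ + a₃) a₄ (a₃ - a₄) a₃ minor₀₁ (+≉0 t₃ t₄ τ₃+τ₄≉0))
    (minor≉0 (a₁ - a₂ + a₃) a₄ a₁ a₂ minor₀₂ τ₃≉0)
    (minor≉0 (a₁ - a₂ + a₃) a₄ (a₁ - a₂ + a₃ - a₄) a₁ minor₀₃ (+≉0 t₂ t₃ τ₂+τ₃≉0))
    (minor≉0 (a₃ - a₄) a₃ a₁ a₂ minor₁₂ τ₀≉0)
    (minor≉0 (a₃ - a₄) a₃ (a₁ - a₂ + a₃ - a₄) a₁ minor₁₃ τ₂≉0)
    (minor≉0 a₁ a₂ (a₁ - a₂ + a₃ - a₄) a₁ minor₂₃ (+≉0 t₁ t₂ τ₁+τ₂≉0))

  nonsingular : ∀ i j → i ≢ j → Nonsingular i j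
  nonsingular i j i≢j with Fin.<-cmp i j
  ... | tri< i<j _ _ = nonsingular-< i<j
  ... | tri≈ _ i≡j _ = contradiction i≡j i≢j
  ... | tri> _ _ j<i = λ eq → nonsingular-< j<i
    (trans (*-comm (D j 0F) (D i 1F)) (trans (sym eq) (*-comm (D i 0F) (D j 1F))))

theorem5p2 : ∀ {c ℓ} (p : ℕ) (pr : Prime p) → p % 5 ≡ 1 →
    (α : ℕ) → 1 ≤ α → let q = p ^ α in
    (F : FiniteField q c ℓ) →
    (a₁ a₂ a₃ a₄ : ℤ) →
    -- (i)
    + q / 1 ≃ (a₁ * a₁ + a₂ * a₂ + a₃ * a₃ + a₄ * a₄) / 1
      -ℚ ½ *ℚ ((a₁ * a₂ + a₂ * a₃ + a₃ * a₄ + a₁ * a₃ + a₂ * a₄ + a₁ * a₄) / 1) →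
    -- (ii)
    a₁ * a₂ + a₂ * a₃ + a₃ * a₄ ≡ a₁ * a₃ + a₂ * a₄ + a₁ * a₄ →
    -- (iii)
    + 5 ∣ℤ (+ 1 + a₁ + a₂ + a₃ + a₄) →
    -- (iv)
    + 5 ∣ℤ (a₁ + + 2 * a₂ + + 3 * a₃ + + 4 * a₄) →
    -- (v)
    ¬ (fromℤ (+ p) ℤ[ζ]-Ring.∣ (H a₁ a₂ a₃ a₄ ℤ[ζ]-Ring.* σ₂ (H a₁ a₂ a₃ a₄))) →
    let open Coding F
        D = matrixD p {{prime⇒nonZero pr}} a₁ a₂ a₃ a₄
        G = transpose D
    in (∀ (i j : Fin 4) → i ≢ j → LinearlyIndependent (D i ∷ D j ∷ []))
       × (∃[ C ] (IsGeneratorMatrix G C × IsMDSCode 4 2 3 C))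
theorem5p2 p pr _ α 1≤α F a₁ a₂ a₃ a₄ i ii _ _ v =
  -- The code is the row space of `G`, inferred from the basis proof.
  rowPairs-independent D nonsingular , _ , G-isBasis D nonsingular , span-isMDSCode D nonsingular
  where
  open MinorsNonzero pr {α} 1≤α F a₁ a₂ a₃ a₄ i ii v using (D; nonsingular)
  open Span F
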